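{- For every $N\ge0$, \[ y\,\bar Z_N=\sum_{H}\mathrm{wt}(H)\,\beta^{t_1(H)-1}\alpha^{t_2(H)}, \] where the sum is over all Laguerre histories $H$ of $N+1$ steps, $\mathrm{wt}(H)$ is the total weight of $H$, $t_1(H)$ is the number of type 1 steps of $H$, and $t_2(H)$ is the number of type 2 steps of $H$ lying to the right of every type 1 step of $H$.
   Context: Let $\mathcal A$ be the associative algebra over $\mathbb Z[y,q]$ generated by $D,E$ subject to $DE-qED=D+E$; every element is uniquely a finite $\mathbb Z[y,q]$-combination of words $E^iD^j$, and we write $(yD+E)^N=\sum_{i,j}c^{(N)}_{i,j}E^iD^j$. Define $\bar Z_N(\alpha,\beta,y,q)=\sum_{i,j}c^{(N)}_{i,j}\alpha^{i}\beta^{j}$ (the PASEP partition function with $\alpha,\beta$ replaced by $1/\alpha,1/\beta$). A Laguerre history of size $n$ is a Motzkin path of $n$ steps in which each step carries a weight: a step $\nearrow$ starting at height $h$ has weight $yq^i$ for some $i\in\{0,\dots,h\}$; a step $\rightarrow$ starting at height $h$ has weight either $yq^i$ for some $i\in\{0,\dots,h\}$ or $q^i$ for some $i\in\{0,\dots,h-1\}$; a step $\searrow$ starting at height $h$ has weight $q^i$ for some $i\in\{0,\dots,h-1\}$. Histories with the same path but different weight choices are distinct. Its total weight is the product of the weights of its steps. A type 1 step is a step with weight $yq^h$ and a type 2 step is a step with weight $q^{h-1}$, where $h$ is its starting height. -}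

module Defs where

open import Level using (Level)
open import Data.Nat using (ℕ; zero; suc; _∸_) renaming (_+_ to _+ℕ_)
open import Data.Bool using (Bool; true; false; if_then_else_)
open import Data.List using (List; []; _∷_; _++_; map; concatMap; upTo; length; filter; reverse; foldr)
open import Data.Product using (_×_; _,_)
open import Algebra.Bundles using (CommutativeRing)

-- A weighted step.  The natural number is the exponent i of q:
--   up i     : a ↗ step with weight y q^i      (0 ≤ i ≤ h)
--   flatY i  : a → step with weight y q^i      (0 ≤ i ≤ h)
--   flatQ i  : a → step with weight q^i        (0 ≤ i ≤ h-1)
--   down i   : a ↘ step with weight q^i        (0 ≤ i ≤ h-1)
-- where h is the starting height of the step.
data Step : Set where
  up flatY flatQ down : ℕ → Step

histFrom : ℕ → ℕ → List (List Step)
histFrom zero zero = [] ∷ []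
histFrom zero (suc h) = []
histFrom (suc n) h =
     concatMap (λ i → map (up i ∷_) (histFrom n (suc h))) (upTo (suc h))
  ++ concatMap (λ i → map (flatY i ∷_) (histFrom n h)) (upTo (suc h))
  ++ concatMap (λ i → map (flatQ i ∷_) (histFrom n h)) (upTo h)
  ++ downs h
  where
  downs : ℕ → List (List Step)
  downs zero = []
  downs (suc h') = concatMap (λ i → map (down i ∷_) (histFrom n h')) (upTo (suc h'))

-- All Laguerre histories of size n (each listed exactly once).
Laguerre : ℕ → List (List Step)
Laguerre n = histFrom n 0

data Kind : Set where
  type1 type2 other : Kind

_==_ : ℕ → ℕ → Bool
zero == zero = true
zero == suc _ = false
suc _ == zero = false
suc m == suc n = m == n

kindAt : ℕ → Step → Kind
kindAt h (up i)    = if i == h then type1 else other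
kindAt h (flatY i) = if i == h then type1 else other
kindAt zero (flatQ i) = other
kindAt (suc h) (flatQ i) = if i == h then type2 else other
kindAt zero (down i) = other
kindAt (suc h) (down i) = if i == h then type2 else other

next : ℕ → Step → ℕ
next h (up _) = suc h
next h (flatY _) = h
next h (flatQ _) = h
next h (down _) = h ∸ 1

kindsFrom : ℕ → List Step → List Kind
kindsFrom h [] = []
kindsFrom h (s ∷ ss) = kindAt h s ∷ kindsFrom (next h s) ss

kinds : List Step → List Kind
kinds = kindsFrom 0

count : (Kind → Bool) → List Kind → ℕ
count p [] = 0
count p (k ∷ ks) = if p k then suc (count p ks) else count p ks

isType1 isType2 : Kind → Bool
isType1 type1 = true
isType1 _ = false
isType2 type2 = true
isType2 _ = false

t₁ : List Step → ℕ
t₁ H = count isType1 (kinds H)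

afterLastType1 : List Kind → List Kind
afterLastType1 ks = reverse (takeWhileNot1 (reverse ks))
  where
  takeWhileNot1 : List Kind → List Kind
  takeWhileNot1 [] = []
  takeWhileNot1 (type1 ∷ _) = []
  takeWhileNot1 (k ∷ ks') = k ∷ takeWhileNot1 ks'

t₂ : List Step → ℕ
t₂ H = count isType2 (afterLastType1 (kinds H))

module _ {c ℓ : Level} (R : CommutativeRing c ℓ) where
  open CommutativeRing R

  pow : Carrier → ℕ → Carrier
  pow x zero = 1#
  pow x (suc n) = x * pow x n

  -- a term  (a, i, j)  stands for  a · E^i D^j
  Term : Set c
  Term = Carrier × ℕ × ℕ

  -- An element of 𝒜 (with coefficients evaluated in R) is represented as a
  -- formal sum of normally ordered words E^i D^j (a list of terms).

  -- normal ordering of D^j E, using DE = qED + D + E: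
  -- D^{j+1} E = q (D^j E) D + D^{j+1} + D^j E
  DpowE : Carrier → ℕ → List Term
  DpowE q zero = (1# , 1 , 0) ∷ []
  DpowE q (suc j) =
       map (λ { (a , i , k) → (q * a , i , suc k) }) (DpowE q j)
    ++ ((1# , 0 , suc j) ∷ [])
    ++ DpowE q j

  mulTerm : Carrier → Carrier → Term → List Term
  mulTerm y q (a , i , j) =
    (y * a , i , suc j) ∷
    map (λ { (b , i' , j') → (a * b , i +ℕ i' , j') }) (DpowE q j)

  yDEpow : Carrier → Carrier → ℕ → List Term
  yDEpow y q zero = (1# , 0 , 0) ∷ []
  yDEpow y q (suc N) = concatMap (mulTerm y q) (yDEpow y q N)

  Zbar : (α β y q : Carrier) → ℕ → Carrier
  Zbar α β y q N =
    foldr (λ { (a , i , j) acc → a * pow α i * pow β j + acc }) 0# (yDEpow y q N)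

  stepWeight : (y q : Carrier) → Step → Carrier
  stepWeight y q (up i) = y * pow q i
  stepWeight y q (flatY i) = y * pow q i
  stepWeight y q (flatQ i) = pow q i
  stepWeight y q (down i) = pow q i

  wt : (y q : Carrier) → List Step → Carrier
  wt y q [] = 1#
  wt y q (s ∷ ss) = stepWeight y q s * wt y q ss

  historySum : (α β y q : Carrier) → ℕ → Carrier
  historySum α β y q n =
    foldr (λ H acc → wt y q H * pow β (t₁ H ∸ 1) * pow α (t₂ H) + acc) 0# (Laguerre n)

{-
Split a history sum from height h according to whether a type 1 step occurs:
A n h (none, weighted α^{t₂}) and B n h (some, weighted β^{t₁-1} α^{t₂}).  With
u n h = A n h + A n (h+1) and w n h = B n h + B n (h+1), the histories of N+1
steps from height 0 give y (u N 0 + β w N 0).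

Words are evaluated in a right module of the algebra in which a vector `one`
satisfies one·E = α one, and the coordinate at 0 turns D into β.  Reading β as
D in the recursion of w lifts it to module elements ŵ, which satisfy

    ŵ_n(h)·E = y (u_n(h+1) one + ŵ_n(h+1)·D)

by induction on n.  This gives v_{n+1} = v_n·(yD + E) for the lift
v_n = u_n(0) one + ŵ_n(0)·D of u n 0 + β w n 0, hence v_N = one·(yD + E)^N.
-}
module Submission where

open import Defs
open import Level using (Level)
open import Data.Nat using (ℕ; zero; suc; _∸_; _<_; _≤_; s≤s) renaming (_+_ to _+ℕ_)
open import Data.Nat.Properties using (≤-refl; ≤-trans; n≤1+n)
import Data.Nat.Properties as ℕ
open import Data.Bool using (Bool; true; false; if_then_else_)
open import Data.List using (List; []; _∷_; _++_; _∷ʳ_; map; concatMap; upTo; reverse; foldr)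
open import Data.List.Properties using (upTo-∷ʳ; concatMap-++; ++-identityʳ; unfold-reverse)
open import Data.Product using (_,_)
open import Function using (_∘_)
open import Algebra.Bundles using (CommutativeRing)
open import Relation.Binary.PropositionalEquality as ≡ using (_≡_)
import Algebra.Solver.Ring.NaturalCoefficients.Default as Solver
import Algebra.Properties.AbelianGroup as AbelianGroupProperties
import Relation.Binary.Reasoning.Setoid as SetoidReasoning

-- Counting type 1 and type 2 in lists of kinds.

==-refl : ∀ n → (n == n) ≡ true
==-refl zero = ≡.refl
==-refl (suc n) = ==-refl n

<⇒==-false : ∀ {i k} → i < k → (i == k) ≡ false
<⇒==-false {zero} {suc k} _ = ≡.refl
<⇒==-false {suc i} {suc k} (s≤s i<k) = <⇒==-false i<k

-- A copy of the local function of afterLastType1, which cannot be named here.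
untilType1 : List Kind → List Kind
untilType1 [] = []
untilType1 (type1 ∷ ks) = []
untilType1 (type2 ∷ ks) = type2 ∷ untilType1 ks
untilType1 (other ∷ ks) = other ∷ untilType1 ks

-- The underscore in local≡ is that local function, found by unification when
-- afterLastType1≡ is checked; abstracting reverse to a variable makes the
-- unification problem injective.
mutual
  afterLastType1≡ : ∀ ks → afterLastType1 ks ≡ reverse (untilType1 (reverse ks))
  afterLastType1≡ ks with reverse ks
  ... | js with reverse {A = Kind}
  ...   | rev = ≡.cong rev (local≡ ks js)

  local≡ : ∀ (ks js : List Kind) → _ ≡ untilType1 js
  local≡ ks [] = ≡.refl
  local≡ ks (type1 ∷ js) = ≡.refl
  local≡ ks (type2 ∷ js) = ≡.cong (type2 ∷_) (local≡ ks js)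
  local≡ ks (other ∷ js) = ≡.cong (other ∷_) (local≡ ks js)

count-++ : ∀ p ks js → count p (ks ++ js) ≡ count p ks +ℕ count p js
count-++ p [] js = ≡.refl
count-++ p (k ∷ ks) js with p k
... | true  = ≡.cong suc (count-++ p ks js)
... | false = count-++ p ks js

count-reverse : ∀ p ks → count p (reverse ks) ≡ count p ks
count-reverse p [] = ≡.refl
count-reverse p (k ∷ ks)
  rewrite unfold-reverse k ks | count-++ p (reverse ks) (k ∷ []) | count-reverse p ks
  with p k
... | true  = ℕ.+-comm (count p ks) 1
... | false = ℕ.+-identityʳ (count p ks)

-- Prepending a kind to a list appends it to the reversed list. The backward scan therefore reaches
-- the new head only if no type 1 has stopped it before; this lemma and the next are the two cases.
untilType1-∷ʳ-none : ∀ ks k → count isType1 ks ≡ 0 → untilType1 (ks ∷ʳ k) ≡ ks ++ untilType1 (k ∷ [])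
untilType1-∷ʳ-none [] k _ = ≡.refl
untilType1-∷ʳ-none (type2 ∷ ks) k p = ≡.cong (type2 ∷_) (untilType1-∷ʳ-none ks k p)
untilType1-∷ʳ-none (other ∷ ks) k p = ≡.cong (other ∷_) (untilType1-∷ʳ-none ks k p)

untilType1-∷ʳ-some : ∀ ks k {n} → count isType1 ks ≡ suc n → untilType1 (ks ∷ʳ k) ≡ untilType1 ks
untilType1-∷ʳ-some (type1 ∷ ks) k _ = ≡.refl
untilType1-∷ʳ-some (type2 ∷ ks) k p = ≡.cong (type2 ∷_) (untilType1-∷ʳ-some ks k p)
untilType1-∷ʳ-some (other ∷ ks) k p = ≡.cong (other ∷_) (untilType1-∷ʳ-some ks k p)

-- The statistic `t₂`, as a function of the list of kinds alone.
final₂ : List Kind → ℕ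
final₂ ks = count isType2 (afterLastType1 ks)

final₂≡ : ∀ ks → final₂ ks ≡ count isType2 (untilType1 (reverse ks))
final₂≡ ks = ≡.trans (≡.cong (count isType2) (afterLastType1≡ ks))
                     (count-reverse isType2 (untilType1 (reverse ks)))

final₂-some : ∀ k ks {n} → count isType1 ks ≡ suc n → final₂ (k ∷ ks) ≡ final₂ ks
final₂-some k ks p = begin
  final₂ (k ∷ ks)                                 ≡⟨ final₂≡ (k ∷ ks) ⟩
  count isType2 (untilType1 (reverse (k ∷ ks)))   ≡⟨ ≡.cong (count isType2 ∘ untilType1) (unfold-reverse k ks) ⟩
  count isType2 (untilType1 (reverse ks ∷ʳ k))
    ≡⟨ ≡.cong (count isType2) (untilType1-∷ʳ-some (reverse ks) k (≡.trans (count-reverse isType1 ks) p)) ⟩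
  count isType2 (untilType1 (reverse ks))         ≡⟨ final₂≡ ks ⟨
  final₂ ks                                       ∎
  where open ≡.≡-Reasoning

final₂-none : ∀ k ks → count isType1 ks ≡ 0 →
  final₂ (k ∷ ks) ≡ count isType2 ks +ℕ count isType2 (untilType1 (k ∷ []))
final₂-none k ks p = begin
  final₂ (k ∷ ks)                                 ≡⟨ final₂≡ (k ∷ ks) ⟩
  count isType2 (untilType1 (reverse (k ∷ ks)))   ≡⟨ ≡.cong (count isType2 ∘ untilType1) (unfold-reverse k ks) ⟩
  count isType2 (untilType1 (reverse ks ∷ʳ k))
    ≡⟨ ≡.cong (count isType2) (untilType1-∷ʳ-none (reverse ks) k (≡.trans (count-reverse isType1 ks) p)) ⟩
  count isType2 (reverse ks ++ untilType1 (k ∷ []))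
    ≡⟨ count-++ isType2 (reverse ks) (untilType1 (k ∷ [])) ⟩
  count isType2 (reverse ks) +ℕ count isType2 (untilType1 (k ∷ []))
    ≡⟨ ≡.cong (_+ℕ count isType2 (untilType1 (k ∷ []))) (count-reverse isType2 ks) ⟩
  count isType2 ks +ℕ count isType2 (untilType1 (k ∷ [])) ∎
  where open ≡.≡-Reasoning

module _ {c ℓ : Level} (R : CommutativeRing c ℓ) where
  open CommutativeRing R hiding (zero)
  open Solver commutativeSemiring using (solve; _:=_; _:+_; _:*_; con)
  open SetoidReasoning setoid
  open AbelianGroupProperties +-abelianGroup using (xyx⁻¹≈y)

  -- Finite sums over lists.

  sumOver : ∀ {a} {X : Set a} → (X → Carrier) → List X → Carrier
  sumOver f = foldr (λ x acc → f x + acc) 0#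

  sumOver-cong : ∀ {a} {X : Set a} {f g : X → Carrier} → (∀ x → f x ≈ g x) →
    ∀ xs → sumOver f xs ≈ sumOver g xs
  sumOver-cong f≈g [] = refl
  sumOver-cong f≈g (x ∷ xs) = +-cong (f≈g x) (sumOver-cong f≈g xs)

  sumOver-++ : ∀ {a} {X : Set a} (f : X → Carrier) xs ys →
    sumOver f (xs ++ ys) ≈ sumOver f xs + sumOver f ys
  sumOver-++ f [] ys = sym (+-identityˡ _)
  sumOver-++ f (x ∷ xs) ys = trans (+-congˡ (sumOver-++ f xs ys)) (sym (+-assoc _ _ _))

  sumOver-map : ∀ {a b} {X : Set a} {Y : Set b} (f : Y → Carrier) (t : X → Y) xs →
    sumOver f (map t xs) ≡ sumOver (f ∘ t) xs
  sumOver-map f t [] = ≡.refl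
  sumOver-map f t (x ∷ xs) = ≡.cong (f (t x) +_) (sumOver-map f t xs)

  sumOver-concatMap : ∀ {a b} {X : Set a} {Y : Set b} (f : Y → Carrier) (t : X → List Y) xs →
    sumOver f (concatMap t xs) ≈ sumOver (λ x → sumOver f (t x)) xs
  sumOver-concatMap f t [] = refl
  sumOver-concatMap f t (x ∷ xs) =
    trans (sumOver-++ f (t x) (concatMap t xs)) (+-congˡ (sumOver-concatMap f t xs))

  sumOver-+ : ∀ {a} {X : Set a} (f g : X → Carrier) xs →
    sumOver (λ x → f x + g x) xs ≈ sumOver f xs + sumOver g xs
  sumOver-+ f g [] = sym (+-identityˡ _)
  sumOver-+ f g (x ∷ xs) = trans (+-congˡ (sumOver-+ f g xs))
    (solve 4 (λ a b s t → (a :+ b) :+ (s :+ t) := (a :+ s) :+ (b :+ t)) refl _ _ _ _)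

  sumOver-* : ∀ {a} {X : Set a} (r : Carrier) (f : X → Carrier) xs →
    sumOver (λ x → r * f x) xs ≈ r * sumOver f xs
  sumOver-* r f [] = sym (zeroʳ r)
  sumOver-* r f (x ∷ xs) = trans (+-congˡ (sumOver-* r f xs)) (sym (distribˡ r _ _))

  module Histories (α β y q : Carrier) where

    -- q-integers, and history sums decomposed by the first step.

    [_]q : ℕ → Carrier
    [ zero ]q = 0#
    [ suc n ]q = [ n ]q + pow R q n

    -- Splits off the constant term where the definition splits off the top power; the commutation
    -- relation `E-D` rests on this form.
    [1+n]q : ∀ n → [ suc n ]q ≈ 1# + q * [ n ]q
    [1+n]q zero = solve 1 (λ q → con 0 :+ con 1 := con 1 :+ q :* con 0) refl q
    [1+n]q (suc n) = trans (+-congʳ ([1+n]q n))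
      (solve 3 (λ q b p → (con 1 :+ q :* b) :+ q :* p := con 1 :+ q :* (b :+ p)) refl q [ n ]q (pow R q n))

    -- Both statistics depend only on the kinds of the steps, so the first-step recursion is proved
    -- once for an arbitrary function `g` of the list of kinds.
    weigh : (List Kind → Carrier) → ℕ → List Step → Carrier
    weigh g h H = wt R y q H * g (kindsFrom h H)

    total : (List Kind → Carrier) → ℕ → ℕ → Carrier
    total g n h = sumOver (weigh g h) (histFrom n h)

    total-cong : ∀ {g g'} → (∀ ks → g ks ≈ g' ks) → ∀ n h → total g n h ≈ total g' n h
    total-cong g≈g' n h = sumOver-cong (λ H → *-congˡ (g≈g' _)) (histFrom n h)

    total-+ : ∀ g g' n h → total (λ ks → g ks + g' ks) n h ≈ total g n h + total g' n h
    total-+ g g' n h = trans (sumOver-cong (λ H → distribˡ _ _ _) (histFrom n h))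
                             (sumOver-+ (weigh g h) (weigh g' h) (histFrom n h))

    total-* : ∀ r g n h → total (λ ks → r * g ks) n h ≈ r * total g n h
    total-* r g n h = trans
      (sumOver-cong (λ H → solve 3 (λ w r g → w :* (r :* g) := r :* (w :* g)) refl _ r _) (histFrom n h))
      (sumOver-* r (weigh g h) (histFrom n h))

    -- Common form of the four families of steps: `ω` is `y` or `1#`, all steps of a family lead
    -- from `h` to `h'`, and the exponent `k` alone has the special kind `K`.
    module _ (g : List Kind → Carrier) (n h h' : ℕ) (s : ℕ → Step) (K : Kind) (k : ℕ) (ω : Carrier)
      (s-weight : ∀ i → stepWeight R y q (s i) ≈ ω * pow R q i)
      (s-kind : ∀ i → kindAt h (s i) ≡ (if i == k then K else other))
      (s-next : ∀ i → next h (s i) ≡ h') where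

      private
        after : ℕ → List (List Step)
        after i = map (s i ∷_) (histFrom n h')

      total-after : ∀ i → sumOver (weigh g h) (after i) ≈
        (ω * pow R q i) * total (λ ks → g ((if i == k then K else other) ∷ ks)) n h'
      total-after i = begin
        sumOver (weigh g h) (after i)
          ≡⟨ sumOver-map (weigh g h) (s i ∷_) (histFrom n h') ⟩
        sumOver (weigh g h ∘ (s i ∷_)) (histFrom n h')
          ≈⟨ sumOver-cong pointwise (histFrom n h') ⟩
        sumOver (λ H → (ω * pow R q i) * weigh g' h' H) (histFrom n h')
          ≈⟨ sumOver-* _ (weigh g' h') (histFrom n h') ⟩
        (ω * pow R q i) * total g' n h' ∎
        where
        g' : List Kind → Carrier
        g' ks = g ((if i == k then K else other) ∷ ks)
        pointwise : ∀ H → weigh g h (s i ∷ H) ≈ (ω * pow R q i) * weigh g' h' H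
        pointwise H rewrite s-kind i | s-next i = trans (*-congʳ (*-congʳ (s-weight i))) (*-assoc _ _ _)

      sumOver-after-suc : ∀ m → sumOver (weigh g h) (concatMap after (upTo (suc m))) ≈
        sumOver (weigh g h) (concatMap after (upTo m)) + sumOver (weigh g h) (after m)
      sumOver-after-suc m = begin
        sumOver (weigh g h) (concatMap after (upTo (suc m)))
          ≡⟨ ≡.cong (sumOver (weigh g h) ∘ concatMap after) (upTo-∷ʳ m) ⟨
        sumOver (weigh g h) (concatMap after (upTo m ∷ʳ m))
          ≡⟨ ≡.cong (sumOver (weigh g h)) (concatMap-++ after (upTo m) (m ∷ [])) ⟩
        sumOver (weigh g h) (concatMap after (upTo m) ++ (after m ++ []))
          ≡⟨ ≡.cong (λ l → sumOver (weigh g h) (concatMap after (upTo m) ++ l)) (++-identityʳ (after m)) ⟩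
        sumOver (weigh g h) (concatMap after (upTo m) ++ after m)
          ≈⟨ sumOver-++ (weigh g h) (concatMap after (upTo m)) (after m) ⟩
        sumOver (weigh g h) (concatMap after (upTo m)) + sumOver (weigh g h) (after m) ∎

      total-steps-other : (∀ ks → g (other ∷ ks) ≈ g ks) → ∀ m → m ≤ k →
        sumOver (weigh g h) (concatMap after (upTo m)) ≈ ω * ([ m ]q * total g n h')
      total-steps-other g-other zero _ = sym (trans (*-congˡ (zeroˡ _)) (zeroʳ _))
      total-steps-other g-other (suc m) m<k = begin
        sumOver (weigh g h) (concatMap after (upTo (suc m)))
          ≈⟨ sumOver-after-suc m ⟩
        sumOver (weigh g h) (concatMap after (upTo m)) + sumOver (weigh g h) (after m)
          ≈⟨ +-cong (total-steps-other g-other m (≤-trans (n≤1+n m) m<k)) (total-after m) ⟩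
        ω * ([ m ]q * total g n h') + (ω * pow R q m) * total (λ ks → g ((if m == k then K else other) ∷ ks)) n h'
          ≡⟨ ≡.cong (λ b → ω * ([ m ]q * total g n h') +
               (ω * pow R q m) * total (λ ks → g ((if b then K else other) ∷ ks)) n h') (<⇒==-false m<k) ⟩
        ω * ([ m ]q * total g n h') + (ω * pow R q m) * total (g ∘ (other ∷_)) n h'
          ≈⟨ +-congˡ (*-congˡ (total-cong g-other n h')) ⟩
        ω * ([ m ]q * total g n h') + (ω * pow R q m) * total g n h'
          ≈⟨ solve 4 (λ w b p t → w :* (b :* t) :+ (w :* p) :* t := w :* ((b :+ p) :* t)) refl ω [ m ]q (pow R q m) _ ⟩
        ω * ([ suc m ]q * total g n h') ∎

      -- The exponents below `k` give steps of kind `other`, whose powers of `q` add up to `[ k ]q`;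
      -- the exponent `k` gives the single step of kind `K`.
      total-steps : (∀ ks → g (other ∷ ks) ≈ g ks) →
        sumOver (weigh g h) (concatMap after (upTo (suc k))) ≈
        ω * ([ k ]q * total g n h' + pow R q k * total (g ∘ (K ∷_)) n h')
      total-steps g-other = begin
        sumOver (weigh g h) (concatMap after (upTo (suc k)))
          ≈⟨ sumOver-after-suc k ⟩
        sumOver (weigh g h) (concatMap after (upTo k)) + sumOver (weigh g h) (after k)
          ≈⟨ +-cong (total-steps-other g-other k ≤-refl) (total-after k) ⟩
        ω * ([ k ]q * total g n h') + (ω * pow R q k) * total (λ ks → g ((if k == k then K else other) ∷ ks)) n h'
          ≡⟨ ≡.cong (λ b → ω * ([ k ]q * total g n h') +
               (ω * pow R q k) * total (λ ks → g ((if b then K else other) ∷ ks)) n h') (==-refl k) ⟩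
        ω * ([ k ]q * total g n h') + (ω * pow R q k) * total (g ∘ (K ∷_)) n h'
          ≈⟨ solve 4 (λ w x p t → w :* x :+ (w :* p) :* t := w :* (x :+ p :* t)) refl ω _ (pow R q k) _ ⟩
        ω * ([ k ]q * total g n h' + pow R q k * total (g ∘ (K ∷_)) n h') ∎

    module _ (g : List Kind → Carrier) (g-other : ∀ ks → g (other ∷ ks) ≈ g ks) (n : ℕ) where

      ySteps : ℕ → Carrier
      ySteps h = y * ([ h ]q * total g n (suc h) + pow R q h * total (g ∘ (type1 ∷_)) n (suc h))
               + y * ([ h ]q * total g n h + pow R q h * total (g ∘ (type1 ∷_)) n h)

      -- From height `suc h` the exponents of these steps run only up to `h`, and `h` is the type 2
      -- exponent. From height 0 there are no such steps.
      qSteps : ℕ → Carrier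
      qSteps zero = 0#
      qSteps (suc h) = 1# * ([ h ]q * total g n (suc h) + pow R q h * total (g ∘ (type2 ∷_)) n (suc h))
                     + 1# * ([ h ]q * total g n h + pow R q h * total (g ∘ (type2 ∷_)) n h)

      ySteps-first : ∀ h rest → sumOver (weigh g h)
        (concatMap (λ i → map (up i ∷_) (histFrom n (suc h))) (upTo (suc h))
          ++ concatMap (λ i → map (flatY i ∷_) (histFrom n h)) (upTo (suc h)) ++ rest)
        ≈ ySteps h + sumOver (weigh g h) rest
      ySteps-first h rest = trans
        (sumOver-++ (weigh g h) (concatMap (λ i → map (up i ∷_) (histFrom n (suc h))) (upTo (suc h))) _)
        (trans (+-cong
          (total-steps g n h (suc h) up type1 h y (λ i → refl) (λ i → ≡.refl) (λ i → ≡.refl) g-other)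
          (trans
            (sumOver-++ (weigh g h) (concatMap (λ i → map (flatY i ∷_) (histFrom n h)) (upTo (suc h))) rest)
            (+-congʳ
              (total-steps g n h h flatY type1 h y (λ i → refl) (λ i → ≡.refl) (λ i → ≡.refl) g-other))))
        (sym (+-assoc _ _ _)))

      total-suc : ∀ h → total g (suc n) h ≈ ySteps h + qSteps h
      total-suc zero = ySteps-first zero []
      total-suc (suc h) = trans (ySteps-first (suc h) _) (+-congˡ (trans
        (sumOver-++ (weigh g (suc h)) (concatMap (λ i → map (flatQ i ∷_) (histFrom n (suc h))) (upTo (suc h)))
          (concatMap (λ i → map (down i ∷_) (histFrom n h)) (upTo (suc h))))
        (+-cong
          (total-steps g n (suc h) (suc h) flatQ type2 h 1# (λ i → sym (*-identityˡ _)) (λ i → ≡.refl) (λ i → ≡.refl) g-other)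
          (total-steps g n (suc h) h down type2 h 1# (λ i → sym (*-identityˡ _)) (λ i → ≡.refl) (λ i → ≡.refl) g-other))))

    total-0 : ∀ n h → total (λ _ → 0#) n h ≈ 0#
    total-0 n h = trans (total-cong (λ _ → sym (zeroˡ 0#)) n h) (trans (total-* 0# (λ _ → 0#) n h) (zeroˡ _))

    -- The weight of a history, split by the presence of a type 1 step.

    weight⁻ : List Kind → Carrier
    weight⁻ [] = 1#
    weight⁻ (type1 ∷ ks) = 0#
    weight⁻ (type2 ∷ ks) = α * weight⁻ ks
    weight⁻ (other ∷ ks) = weight⁻ ks

    -- A leading type 1 contributes `β` if another one follows. If none follows, it is the one
    -- discounted in the exponent t₁ - 1, and the remaining factor is `weight⁻`. A type 2
    -- contributes no `α`, because here it counts only after the last type 1.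
    weight⁺ : List Kind → Carrier
    weight⁺ [] = 0#
    weight⁺ (type1 ∷ ks) = weight⁻ ks + β * weight⁺ ks
    weight⁺ (type2 ∷ ks) = weight⁺ ks
    weight⁺ (other ∷ ks) = weight⁺ ks

    weight⁻-none : ∀ ks → count isType1 ks ≡ 0 → weight⁻ ks ≈ pow R α (final₂ ks)
    weight⁻-none ks p = trans (go ks p) (reflexive (≡.cong (pow R α) (≡.sym (final₂≡count ks p))))
      where
      go : ∀ ks → count isType1 ks ≡ 0 → weight⁻ ks ≈ pow R α (count isType2 ks)
      go [] _ = refl
      go (type2 ∷ ks) p = *-congˡ (go ks p)
      go (other ∷ ks) p = go ks p
      final₂≡count : ∀ ks → count isType1 ks ≡ 0 → final₂ ks ≡ count isType2 ks
      final₂≡count [] _ = ≡.refl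
      final₂≡count (type2 ∷ ks) p = ≡.trans (final₂-none type2 ks p) (ℕ.+-comm (count isType2 ks) 1)
      final₂≡count (other ∷ ks) p = ≡.trans (final₂-none other ks p) (ℕ.+-identityʳ _)

    weight⁻-some : ∀ ks {n} → count isType1 ks ≡ suc n → weight⁻ ks ≈ 0#
    weight⁻-some (type1 ∷ ks) p = refl
    weight⁻-some (type2 ∷ ks) p = trans (*-congˡ (weight⁻-some ks p)) (zeroʳ α)
    weight⁻-some (other ∷ ks) p = weight⁻-some ks p

    weight⁺-none : ∀ ks → count isType1 ks ≡ 0 → weight⁺ ks ≈ 0#
    weight⁺-none [] _ = refl
    weight⁺-none (type2 ∷ ks) p = weight⁺-none ks p
    weight⁺-none (other ∷ ks) p = weight⁺-none ks p

    weight⁺-some : ∀ ks {n} → count isType1 ks ≡ suc n → weight⁺ ks ≈ pow R β n * pow R α (final₂ ks)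
    -- Whether the leading type 1 is the only one decides which of the two summands survives.
    weight⁺-some (type1 ∷ ks) ≡.refl with count isType1 ks in p
    ... | zero = begin
      weight⁻ ks + β * weight⁺ ks
        ≈⟨ +-cong (weight⁻-none ks p) (*-congˡ (weight⁺-none ks p)) ⟩
      pow R α (final₂ ks) + β * 0#
        ≈⟨ solve 2 (λ a b → a :+ b :* con 0 := con 1 :* a) refl _ β ⟩
      1# * pow R α (final₂ ks)
        ≡⟨ ≡.cong (λ m → 1# * pow R α m) (final₂-type1 ks p) ⟨
      1# * pow R α (final₂ (type1 ∷ ks)) ∎
      where
      final₂-type1 : ∀ ks → count isType1 ks ≡ 0 → final₂ (type1 ∷ ks) ≡ final₂ ks
      final₂-type1 [] _ = ≡.refl
      final₂-type1 (type2 ∷ ks) p = ≡.trans (final₂-none type1 (type2 ∷ ks) p)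
        (≡.trans (ℕ.+-identityʳ _) (≡.sym (≡.trans (final₂-none type2 ks p) (ℕ.+-comm (count isType2 ks) 1))))
      final₂-type1 (other ∷ ks) p = ≡.trans (final₂-none type1 (other ∷ ks) p) (≡.sym (final₂-none other ks p))
    ... | suc n = begin
      weight⁻ ks + β * weight⁺ ks
        ≈⟨ +-cong (weight⁻-some ks p) (*-congˡ (weight⁺-some ks p)) ⟩
      0# + β * (pow R β n * pow R α (final₂ ks))
        ≈⟨ solve 3 (λ b s t → con 0 :+ b :* (s :* t) := (b :* s) :* t) refl β _ _ ⟩
      pow R β (suc n) * pow R α (final₂ ks)
        ≡⟨ ≡.cong (λ m → pow R β (suc n) * pow R α m) (final₂-some type1 ks p) ⟨
      pow R β (suc n) * pow R α (final₂ (type1 ∷ ks)) ∎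
    weight⁺-some (type2 ∷ ks) {n} p = trans (weight⁺-some ks p)
      (reflexive (≡.cong (λ m → pow R β n * pow R α m) (≡.sym (final₂-some type2 ks p))))
    weight⁺-some (other ∷ ks) {n} p = trans (weight⁺-some ks p)
      (reflexive (≡.cong (λ m → pow R β n * pow R α m) (≡.sym (final₂-some other ks p))))

    -- Exactly one summand can be nonzero. Without a type 1, truncated subtraction makes the
    -- exponent of `β` zero, in agreement with `weight⁻`.
    weight-split : ∀ ks → pow R β (count isType1 ks ∸ 1) * pow R α (final₂ ks) ≈ weight⁻ ks + weight⁺ ks
    weight-split ks with count isType1 ks in p
    ... | zero = trans (solve 1 (λ a → con 1 :* a := a :+ con 0) refl _)
                       (sym (+-cong (weight⁻-none ks p) (weight⁺-none ks p)))
    ... | suc n = trans (sym (+-identityˡ _)) (sym (+-cong (weight⁻-some ks p) (weight⁺-some ks p)))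

    -- Recursions for the two history sums.

    A B : ℕ → ℕ → Carrier
    A = total weight⁻
    B = total weight⁺

    historySum-split : ∀ n → historySum R α β y q n ≈ A n 0 + B n 0
    historySum-split n = trans
      (sumOver-cong (λ H → trans (*-assoc _ _ _) (*-congˡ (weight-split (kinds H)))) (Laguerre n))
      (total-+ weight⁻ weight⁺ n 0)

    u w : ℕ → ℕ → Carrier
    u n h = A n h + A n (suc h)
    w n h = B n h + B n (suc h)

    -- The q-integer `[ suc h ]q` with its top power marked by `α` or `β`: the weight of all choices
    -- of exponent when the top one is a type 2 or a type 1 step.
    a[_] b[_] : ℕ → Carrier
    a[ h ] = [ h ]q + pow R q h * α
    b[ h ] = [ h ]q + pow R q h * β

    -- At height 0 the only exponent available is 0, so the first step is of type 1.
    A-suc-zero : ∀ n → A (suc n) 0 ≈ 0#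
    A-suc-zero n = trans (total-suc weight⁻ (λ _ → refl) n 0) (trans
      (+-congʳ (+-cong (*-congˡ (+-congˡ (*-congˡ (total-0 n 1)))) (*-congˡ (+-congˡ (*-congˡ (total-0 n 0))))))
      (solve 3 (λ y s t → (y :* (con 0 :* s :+ con 1 :* con 0) :+ y :* (con 0 :* t :+ con 1 :* con 0)) :+ con 0 := con 0)
        refl y _ _))

    A-suc-suc : ∀ n h → A (suc n) (suc h) ≈ y * ([ suc h ]q * u n (suc h)) + a[ h ] * u n h
    A-suc-suc n h = trans (total-suc weight⁻ (λ _ → refl) n (suc h)) (trans
      (+-cong
        (+-cong (*-congˡ (+-congˡ (*-congˡ (total-0 n (suc (suc h)))))) (*-congˡ (+-congˡ (*-congˡ (total-0 n (suc h))))))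
        (+-cong (*-congˡ (+-congˡ (*-congˡ (total-* α weight⁻ n (suc h))))) (*-congˡ (+-congˡ (*-congˡ (total-* α weight⁻ n h))))))
      (solve 9 (λ y α b₁ b p₁ p s₂ s₁ s₀ →
         (y :* (b₁ :* s₂ :+ p₁ :* con 0) :+ y :* (b₁ :* s₁ :+ p₁ :* con 0))
         :+ (con 1 :* (b :* s₁ :+ p :* (α :* s₁)) :+ con 1 :* (b :* s₀ :+ p :* (α :* s₀)))
         := y :* (b₁ :* (s₁ :+ s₂)) :+ (b :+ p :* α) :* (s₀ :+ s₁))
        refl y α [ suc h ]q [ h ]q (pow R q (suc h)) (pow R q h) (A n (suc (suc h))) (A n (suc h)) (A n h)))

    -- The contribution of first steps without `y`. A type 1 step is still to come, so a type 2 step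
    -- brings no `α` and the exponents sum to a plain q-integer; `w n h` joins the level and the
    -- descending step.
    downB : ℕ → ℕ → Carrier
    downB n zero = 0#
    downB n (suc h) = [ suc h ]q * w n h

    -- The term in `u` collects the histories whose first step is their only type 1 step.
    B-suc : ∀ n h → B (suc n) h ≈ y * (b[ h ] * w n h + pow R q h * u n h) + downB n h
    B-suc n h = trans (total-suc weight⁺ (λ _ → refl) n h) (+-cong
      (trans
        (+-cong (*-congˡ (+-congˡ (*-congˡ (type1-total (suc h))))) (*-congˡ (+-congˡ (*-congˡ (type1-total h)))))
        (solve 8 (λ y β b p a₁ a₀ b₁ b₀ →
           y :* (b :* b₁ :+ p :* (a₁ :+ β :* b₁)) :+ y :* (b :* b₀ :+ p :* (a₀ :+ β :* b₀))
           := y :* ((b :+ p :* β) :* (b₀ :+ b₁) :+ p :* (a₀ :+ a₁)))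
          refl y β [ h ]q (pow R q h) (A n (suc h)) (A n h) (B n (suc h)) (B n h)))
      (qSteps≈downB h))
      where
      type1-total : ∀ h → total (λ ks → weight⁻ ks + β * weight⁺ ks) n h ≈ A n h + β * B n h
      type1-total h = trans (total-+ weight⁻ (λ ks → β * weight⁺ ks) n h) (+-congˡ (total-* β weight⁺ n h))
      qSteps≈downB : ∀ h → qSteps weight⁺ (λ _ → refl) n h ≈ downB n h
      qSteps≈downB zero = refl
      qSteps≈downB (suc h) =
        solve 4 (λ b p s₁ s₀ → con 1 :* (b :* s₁ :+ p :* s₁) :+ con 1 :* (b :* s₀ :+ p :* s₀) := (b :+ p) :* (s₀ :+ s₁))
          refl [ h ]q (pow R q h) (B n (suc h)) (B n h)

    u-suc-zero : ∀ n → u (suc n) 0 ≈ y * u n 1 + α * u n 0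
    u-suc-zero n = trans (+-cong (A-suc-zero n) (A-suc-suc n 0))
      (solve 4 (λ y α s t → con 0 :+ (y :* ((con 0 :+ con 1) :* s) :+ (con 0 :+ con 1 :* α) :* t) := y :* s :+ α :* t)
        refl y α (u n 1) (u n 0))

    u-suc-suc : ∀ n h → u (suc n) (suc h) ≈
      y * ([ suc h ]q * u n (suc h) + [ suc (suc h) ]q * u n (suc (suc h))) + (a[ h ] * u n h + a[ suc h ] * u n (suc h))
    u-suc-suc n h = trans (+-cong (A-suc-suc n h) (A-suc-suc n (suc h)))
      (solve 5 (λ y s t s' t' → (y :* s :+ t) :+ (y :* s' :+ t') := y :* (s :+ s') :+ (t :+ t')) refl y _ _ _ _)

    w-zero : ∀ h → w 0 h ≈ 0#
    w-zero zero = solve 0 ((con 1 :* con 0 :+ con 0) :+ con 0 := con 0) refl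
    w-zero (suc h) = +-identityˡ 0#

    -- A right module for the relation DE = qED + D + E.

    [1+n]b : ∀ n → b[ suc n ] ≈ 1# + q * b[ n ]
    [1+n]b n = trans (+-congʳ ([1+n]q n))
      (solve 4 (λ q β b p → (con 1 :+ q :* b) :+ (q :* p) :* β := con 1 :+ q :* (b :+ p :* β)) refl q β [ n ]q (pow R q n))

    -- The right module, in row vectors.  D v and E v stand for v·D and v·E, so the
    -- relation DE = qED + D + E becomes E-D, with the order of composition reversed.
    Row : Set c
    Row = ℕ → Carrier

    D E : Row → Row
    D v zero = b[ 0 ] * v 0
    D v (suc m) = b[ suc m ] * v (suc m) + b[ m ] * ([ suc m ]q * v m)
    E v m = [ m ]q * v m + v (suc m)

    -- The coordinates are determined one after another by the eigenvector equation `E-one`,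
    -- starting from 1.
    one : Row
    one zero = 1#
    one (suc m) = (α - [ m ]q) * one m

    E-one : ∀ m → E one m ≈ α * one m
    E-one m = trans (sym (distribʳ (one m) [ m ]q (α - [ m ]q)))
      (*-congʳ (trans (sym (+-assoc _ _ _)) (xyx⁻¹≈y [ m ]q α)))

    -- Coordinatewise this follows from the recursions x ↦ 1 + q x, which both `[_]q` and `b[_]`
    -- satisfy.
    E-D : ∀ v m → E (D v) m ≈ q * D (E v) m + D v m + E v m
    E-D v zero = trans
      (+-congˡ (+-congʳ (*-congʳ ([1+n]b 0))))
      (solve 4 (λ q d v₀ v₁ →
        con 0 :* (d :* v₀) :+ ((con 1 :+ q :* d) :* v₁ :+ d :* ((con 0 :+ con 1) :* v₀))
        := q :* (d :* (con 0 :* v₀ :+ v₁)) :+ d :* v₀ :+ (con 0 :* v₀ :+ v₁))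
        refl q b[ 0 ] (v 0) (v 1))
    E-D v (suc m) = begin
      E (D v) (suc m)
        -- The factors moved to the right end of each product are those to be expanded by the
        -- recursions; other occurrences of `b₁` and `d₁` have to stay as they are.
        ≈⟨ solve 8 (λ b₁ b₂ d₀ d₁ d₂ v₀ v₁ v₂ →
             b₁ :* (d₁ :* v₁ :+ d₀ :* (b₁ :* v₀)) :+ (d₂ :* v₂ :+ d₁ :* (b₂ :* v₁))
             := ((b₁ :* v₁) :* d₁ :+ (d₀ :* b₁ :* v₀) :* b₁) :+ (v₂ :* d₂ :+ (d₁ :* v₁) :* b₂))
             refl b₁ b₂ d₀ d₁ d₂ v₀ v₁ v₂ ⟩
      ((b₁ * v₁) * d₁ + (d₀ * b₁ * v₀) * b₁) + (v₂ * d₂ + (d₁ * v₁) * b₂)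
        ≈⟨ +-cong (+-cong (*-congˡ ([1+n]b m)) (*-congˡ ([1+n]q m)))
                  (+-cong (*-congˡ ([1+n]b (suc m))) (*-congˡ ([1+n]q (suc m)))) ⟩
      ((b₁ * v₁) * (1# + q * d₀) + (d₀ * b₁ * v₀) * (1# + q * [ m ]q))
        + (v₂ * (1# + q * d₁) + (d₁ * v₁) * (1# + q * b₁))
        ≈⟨ solve 8 (λ q b b₁ d₀ d₁ v₀ v₁ v₂ →
             ((b₁ :* v₁) :* (con 1 :+ q :* d₀) :+ (d₀ :* b₁ :* v₀) :* (con 1 :+ q :* b))
               :+ (v₂ :* (con 1 :+ q :* d₁) :+ (d₁ :* v₁) :* (con 1 :+ q :* b₁))
             := q :* (d₁ :* (b₁ :* v₁ :+ v₂) :+ d₀ :* (b₁ :* (b :* v₀ :+ v₁)))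
               :+ (d₁ :* v₁ :+ d₀ :* (b₁ :* v₀)) :+ (b₁ :* v₁ :+ v₂))
             refl q [ m ]q b₁ d₀ d₁ v₀ v₁ v₂ ⟩
      q * D (E v) (suc m) + D v (suc m) + E v (suc m) ∎
      where
      b₁ b₂ d₀ d₁ d₂ v₀ v₁ v₂ : Carrier
      b₁ = [ suc m ]q
      b₂ = [ suc (suc m) ]q
      d₀ = b[ m ]
      d₁ = b[ suc m ]
      d₂ = b[ suc (suc m) ]
      v₀ = v m
      v₁ = v (suc m)
      v₂ = v (suc (suc m))

    D-cong : ∀ {x z : Row} → (∀ m → x m ≈ z m) → ∀ m → D x m ≈ D z m
    D-cong x≈z zero = *-congˡ (x≈z 0)
    D-cong x≈z (suc m) = +-cong (*-congˡ (x≈z (suc m))) (*-congˡ (*-congˡ (x≈z m)))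

    D-+ : ∀ (x z : Row) m → D (λ m → x m + z m) m ≈ D x m + D z m
    D-+ x z zero = distribˡ _ _ _
    D-+ x z (suc m) = solve 7 (λ d₁ d₀ b x₁ x₀ z₁ z₀ →
      d₁ :* (x₁ :+ z₁) :+ d₀ :* (b :* (x₀ :+ z₀)) := (d₁ :* x₁ :+ d₀ :* (b :* x₀)) :+ (d₁ :* z₁ :+ d₀ :* (b :* z₀)))
      refl b[ suc m ] b[ m ] [ suc m ]q (x (suc m)) (x m) (z (suc m)) (z m)

    D-* : ∀ r (x : Row) m → D (λ m → r * x m) m ≈ r * D x m
    D-* r x zero = solve 3 (λ d r x → d :* (r :* x) := r :* (d :* x)) refl b[ 0 ] r (x 0)
    D-* r x (suc m) = solve 6 (λ d₁ d₀ b r x₁ x₀ →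
      d₁ :* (r :* x₁) :+ d₀ :* (b :* (r :* x₀)) := r :* (d₁ :* x₁ :+ d₀ :* (b :* x₀)))
      refl b[ suc m ] b[ m ] [ suc m ]q r (x (suc m)) (x m)

    D-0 : ∀ m → D (λ _ → 0#) m ≈ 0#
    D-0 m = trans (D-cong (λ _ → sym (zeroˡ 0#)) m) (trans (D-* 0# (λ _ → 0#) m) (zeroˡ _))

    E-cong : ∀ {x z : Row} → (∀ m → x m ≈ z m) → ∀ m → E x m ≈ E z m
    E-cong x≈z m = +-cong (*-congˡ (x≈z m)) (x≈z (suc m))

    E-+ : ∀ (x z : Row) m → E (λ m → x m + z m) m ≈ E x m + E z m
    E-+ x z m = solve 5 (λ b x₁ x₀ z₁ z₀ → b :* (x₀ :+ z₀) :+ (x₁ :+ z₁) := (b :* x₀ :+ x₁) :+ (b :* z₀ :+ z₁))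
      refl [ m ]q (x (suc m)) (x m) (z (suc m)) (z m)

    E-* : ∀ r (x : Row) m → E (λ m → r * x m) m ≈ r * E x m
    E-* r x m = solve 4 (λ b r x₁ x₀ → b :* (r :* x₀) :+ r :* x₁ := r :* (b :* x₀ :+ x₁)) refl [ m ]q r (x (suc m)) (x m)

    E-0 : ∀ m → E (λ _ → 0#) m ≈ 0#
    E-0 m = trans (+-identityʳ _) (zeroʳ _)

    -- The lift of `w` to the module and its product with E.

    mutual
      -- Copies the recursion that `B-suc` gives for `w`, at heights `h` and `suc h`, with `ŵ↓` in
      -- place of `downB`.
      ŵ : ℕ → ℕ → Row
      ŵ zero h m = 0#
      ŵ (suc n) h m = y * (v̂ n h m + v̂ n (suc h) m) + (ŵ↓ n h m + [ suc h ]q * ŵ n h m)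

      ŵ↓ : ℕ → ℕ → Row
      ŵ↓ n zero m = 0#
      ŵ↓ n (suc h) m = [ suc h ]q * ŵ n h m

      -- Lifts `b[ h ] * w n h + pow R q h * u n h`, with `β` read as D and the scalar term
      -- multiplied by `one`. At height 0 it is the vector v_n.
      v̂ : ℕ → ℕ → Row
      v̂ n h m = ([ h ]q * ŵ n h m + pow R q h * D (ŵ n h) m) + (pow R q h * u n h) * one m

    D-v̂ : ∀ n h m → D (v̂ n h) m ≈
      ([ h ]q * D (ŵ n h) m + pow R q h * D (D (ŵ n h)) m) + (pow R q h * u n h) * D one m
    D-v̂ n h m = trans (D-+ _ _ m) (+-cong (trans (D-+ _ _ m) (+-cong (D-* _ _ m) (D-* _ _ m))) (D-* _ _ m))

    D-ŵ-suc : ∀ n h m → D (ŵ (suc n) h) m ≈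
      y * (D (v̂ n h) m + D (v̂ n (suc h)) m) + (D (ŵ↓ n h) m + [ suc h ]q * D (ŵ n h) m)
    D-ŵ-suc n h m = trans (D-+ _ _ m) (+-cong
      (trans (D-* _ _ m) (*-congˡ (D-+ _ _ m)))
      (trans (D-+ _ _ m) (+-congˡ (D-* _ _ m))))

    -- Moving E past D by `E-D` yields the extra terms that turn `[ h ]q` into `[ suc h ]q` and
    -- `pow R q h` into `pow R q (suc h)`, which builds `D (v̂ n (suc h))`. The formula for
    -- `E (ŵ n h)` is a hypothesis, so that the induction proving it can use this lemma.
    E-v̂-from : ∀ n h → (∀ m → E (ŵ n h) m ≈ y * (u n (suc h) * one m + D (ŵ n (suc h)) m)) → ∀ m →
      E (v̂ n h) m ≈ y * (D (v̂ n (suc h)) m + [ suc h ]q * u n (suc h) * one m)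
                    + (pow R q h * D (ŵ n h) m + pow R q h * u n h * α * one m)
    E-v̂-from n h E-ŵ m = begin
      E (v̂ n h) m
        ≈⟨ trans
             (E-+ (λ m → [ h ]q * ŵ n h m + pow R q h * D (ŵ n h) m) (λ m → (pow R q h * u n h) * one m) m)
             (+-cong
               (trans (E-+ (λ m → [ h ]q * ŵ n h m) (λ m → pow R q h * D (ŵ n h) m) m)
                 (+-cong (E-* [ h ]q (ŵ n h) m) (E-* (pow R q h) (D (ŵ n h)) m)))
               (E-* (pow R q h * u n h) one m)) ⟩
      ([ h ]q * E (ŵ n h) m + pow R q h * E (D (ŵ n h)) m) + (pow R q h * u n h) * E one m
        ≈⟨ +-cong (+-cong (*-congˡ (E-ŵ m)) (*-congˡ (trans (E-D (ŵ n h) m) (+-cong (+-congʳ (*-congˡ D-E-ŵ)) (E-ŵ m)))))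
                  (*-congˡ (E-one m)) ⟩
      ([ h ]q * (y * (u₁ * one m + Dw₁))
        + pow R q h * (q * (y * (u₁ * D one m + D (D (ŵ n (suc h))) m)) + D (ŵ n h) m + y * (u₁ * one m + Dw₁)))
        + (pow R q h * u n h) * (α * one m)
        ≈⟨ solve 12 (λ q y α b p u₀ u₁ i Di Dw₀ Dw₁ DDw₁ →
             (b :* (y :* (u₁ :* i :+ Dw₁)) :+ p :* (q :* (y :* (u₁ :* Di :+ DDw₁)) :+ Dw₀ :+ y :* (u₁ :* i :+ Dw₁)))
               :+ (p :* u₀) :* (α :* i)
             := y :* ((((b :+ p) :* Dw₁ :+ (q :* p) :* DDw₁) :+ ((q :* p) :* u₁) :* Di) :+ (b :+ p) :* u₁ :* i)
               :+ (p :* Dw₀ :+ p :* u₀ :* α :* i))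
             refl q y α [ h ]q (pow R q h) (u n h) u₁ (one m) (D one m) (D (ŵ n h) m) Dw₁ (D (D (ŵ n (suc h))) m) ⟩
      y * ((([ suc h ]q * Dw₁ + pow R q (suc h) * D (D (ŵ n (suc h))) m) + (pow R q (suc h) * u₁) * D one m)
           + [ suc h ]q * u₁ * one m)
        + (pow R q h * D (ŵ n h) m + pow R q h * u n h * α * one m)
        ≈⟨ +-congʳ (*-congˡ (+-congʳ (D-v̂ n (suc h) m))) ⟨
      y * (D (v̂ n (suc h)) m + [ suc h ]q * u₁ * one m)
        + (pow R q h * D (ŵ n h) m + pow R q h * u n h * α * one m) ∎
      where
      u₁ Dw₁ : Carrier
      u₁ = u n (suc h)
      Dw₁ = D (ŵ n (suc h)) m
      D-E-ŵ : D (E (ŵ n h)) m ≈ y * (u₁ * D one m + D (D (ŵ n (suc h))) m)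
      D-E-ŵ = trans (D-cong E-ŵ m) (trans (D-* _ _ m) (*-congˡ (trans (D-+ _ _ m) (+-congʳ (D-* _ _ m)))))

    -- Induction on `n`, using the heights next to `h` as well. The terms in `one` assemble to
    -- `u-suc-suc`, the others to D of the recursion of `ŵ` at `suc h`.
    E-ŵ : ∀ n h m → E (ŵ n h) m ≈ y * (u n (suc h) * one m + D (ŵ n (suc h)) m)
    -- No history of length 0 starts at a positive height, so `u 0 (suc h)` computes to a sum of
    -- zeros.
    E-ŵ zero h m = trans (E-0 m) (sym (trans (*-congˡ (+-congˡ (D-0 m)))
      (solve 2 (λ y i → y :* ((con 0 :+ con 0) :* i :+ con 0) := con 0) refl y (one m))))
    E-ŵ (suc n) h m = begin
      E (ŵ (suc n) h) m
        ≈⟨ trans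
             (E-+ (λ m → y * (v̂ n h m + v̂ n (suc h) m)) (λ m → ŵ↓ n h m + [ suc h ]q * ŵ n h m) m)
             (+-cong
               (trans (E-* y (λ m → v̂ n h m + v̂ n (suc h) m) m) (*-congˡ (E-+ (v̂ n h) (v̂ n (suc h)) m)))
               (trans (E-+ (ŵ↓ n h) (λ m → [ suc h ]q * ŵ n h m) m) (+-congˡ (E-* [ suc h ]q (ŵ n h) m)))) ⟩
      y * (E (v̂ n h) m + E (v̂ n (suc h)) m) + (E (ŵ↓ n h) m + [ suc h ]q * E (ŵ n h) m)
        ≈⟨ +-cong (*-congˡ (+-cong (E-v̂-from n h (E-ŵ n h) m) (E-v̂-from n (suc h) (E-ŵ n (suc h)) m)))
                  (+-cong (E-ŵ↓ h) (*-congˡ (E-ŵ n h m))) ⟩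
      y * ((y * (Dv₁ + b₁ * u₁ * i) + (p * Dw₀ + p * u₀ * α * i))
           + (y * (Dv₂ + b₂ * u₂ * i) + (p₁ * Dw₁ + p₁ * u₁ * α * i)))
        + (y * ([ h ]q * (u₀ * i + Dw₀)) + b₁ * (y * (u₁ * i + Dw₁)))
        -- The `let` makes the relations between consecutive q-integers and powers of `q` visible to
        -- the solver.
        ≈⟨ solve 13 (λ q y α b p i u₀ u₁ u₂ Dv₁ Dv₂ Dw₀ Dw₁ →
             let b₁ = b :+ p ; p₁ = q :* p ; b₂ = b₁ :+ p₁ in
             y :* ((y :* (Dv₁ :+ b₁ :* u₁ :* i) :+ (p :* Dw₀ :+ p :* u₀ :* α :* i))
               :+ (y :* (Dv₂ :+ b₂ :* u₂ :* i) :+ (p₁ :* Dw₁ :+ p₁ :* u₁ :* α :* i)))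
             :+ (y :* (b :* (u₀ :* i :+ Dw₀)) :+ b₁ :* (y :* (u₁ :* i :+ Dw₁)))
             := y :* ((y :* (b₁ :* u₁ :+ b₂ :* u₂) :+ ((b :+ p :* α) :* u₀ :+ (b₁ :+ p₁ :* α) :* u₁)) :* i
               :+ (y :* (Dv₁ :+ Dv₂) :+ (b₁ :* Dw₀ :+ b₂ :* Dw₁))))
             refl q y α [ h ]q p i u₀ u₁ u₂ Dv₁ Dv₂ Dw₀ Dw₁ ⟩
      y * ((y * (b₁ * u₁ + b₂ * u₂) + (a[ h ] * u₀ + a[ suc h ] * u₁)) * i
           + (y * (Dv₁ + Dv₂) + (b₁ * Dw₀ + b₂ * Dw₁)))
        ≈⟨ *-congˡ (+-cong (*-congʳ (u-suc-suc n h))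
             (trans (D-ŵ-suc n (suc h) m) (+-congˡ (+-congʳ (D-* _ _ m))))) ⟨
      y * (u (suc n) (suc h) * one m + D (ŵ (suc n) (suc h)) m) ∎
      where
      i p p₁ b₁ b₂ u₀ u₁ u₂ Dv₁ Dv₂ Dw₀ Dw₁ : Carrier
      i = one m
      p = pow R q h
      p₁ = pow R q (suc h)
      b₁ = [ suc h ]q
      b₂ = [ suc (suc h) ]q
      u₀ = u n h
      u₁ = u n (suc h)
      u₂ = u n (suc (suc h))
      Dv₁ = D (v̂ n (suc h)) m
      Dv₂ = D (v̂ n (suc (suc h))) m
      Dw₀ = D (ŵ n h) m
      Dw₁ = D (ŵ n (suc h)) m
      E-ŵ↓ : ∀ h → E (ŵ↓ n h) m ≈ y * ([ h ]q * (u n h * one m + D (ŵ n h) m))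
      E-ŵ↓ zero = trans (E-0 m) (sym (trans (*-congˡ (zeroˡ _)) (zeroʳ y)))
      E-ŵ↓ (suc h) = trans (E-* [ suc h ]q (ŵ n h) m) (trans (*-congˡ (E-ŵ n h m))
        (solve 3 (λ b y x → b :* (y :* x) := y :* (b :* x)) refl [ suc h ]q y _))

    -- This is v_{n+1} = v_n (yD + E). At height 0 only `D (ŵ (suc n) 0)` and the multiple of `one`
    -- remain; apart from `y * D (v̂ n 0) m`, their expansion is what `E-v̂-from` gives for
    -- `E (v̂ n 0)`.
    v̂-suc-0 : ∀ n m → v̂ (suc n) 0 m ≈ y * D (v̂ n 0) m + E (v̂ n 0) m
    v̂-suc-0 n m = begin
      v̂ (suc n) 0 m
        ≈⟨ +-cong (+-congˡ (*-congˡ (trans (D-ŵ-suc n 0 m) (+-congˡ (+-congʳ (D-0 m)))))) (*-congʳ (*-congˡ (u-suc-zero n))) ⟩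
      (0# * ŵ (suc n) 0 m + 1# * (y * (Dv₀ + Dv₁) + (0# + [ 1 ]q * Dw₀))) + (1# * (y * u₁ + α * u₀)) * one m
        ≈⟨ solve 9 (λ y α w Dv₀ Dv₁ Dw₀ u₀ u₁ i →
             (con 0 :* w :+ con 1 :* (y :* (Dv₀ :+ Dv₁) :+ (con 0 :+ (con 0 :+ con 1) :* Dw₀)))
               :+ (con 1 :* (y :* u₁ :+ α :* u₀)) :* i
             := y :* Dv₀ :+ (y :* (Dv₁ :+ (con 0 :+ con 1) :* u₁ :* i) :+ (con 1 :* Dw₀ :+ con 1 :* u₀ :* α :* i)))
             refl y α (ŵ (suc n) 0 m) Dv₀ Dv₁ Dw₀ u₀ u₁ (one m) ⟩
      y * Dv₀ + (y * (Dv₁ + [ 1 ]q * u₁ * one m) + (1# * Dw₀ + 1# * u₀ * α * one m))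
        ≈⟨ +-congˡ (E-v̂-from n 0 (E-ŵ n 0) m) ⟨
      y * Dv₀ + E (v̂ n 0) m ∎
      where
      u₀ u₁ Dv₀ Dv₁ Dw₀ : Carrier
      u₀ = u n 0
      u₁ = u n 1
      Dv₀ = D (v̂ n 0) m
      Dv₁ = D (v̂ n 1) m
      Dw₀ = D (ŵ n 0) m

    -- Back to history sums through the coordinate at 0.

    mutual
      -- At coordinate 0, D multiplies by `b[ 0 ]`, which equals `β`, and `one` is 1, so the lifted
      -- recursion becomes that of `w`.
      ŵ-at-0 : ∀ n h → ŵ n h 0 ≈ w n h
      ŵ-at-0 zero h = sym (w-zero h)
      ŵ-at-0 (suc n) h = begin
        y * (v̂ n h 0 + v̂ n (suc h) 0) + (ŵ↓ n h 0 + [ suc h ]q * ŵ n h 0)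
          ≈⟨ +-cong (*-congˡ (+-cong (v̂-at-0 n h) (v̂-at-0 n (suc h)))) (+-cong (down-at-0 h) (*-congˡ (ŵ-at-0 n h))) ⟩
        y * (x₀ + x₁) + (downB n h + downB n (suc h))
          ≈⟨ solve 5 (λ y s t d d' → y :* (s :+ t) :+ (d :+ d') := (y :* s :+ d) :+ (y :* t :+ d'))
               refl y x₀ x₁ (downB n h) (downB n (suc h)) ⟩
        (y * x₀ + downB n h) + (y * x₁ + downB n (suc h))
          ≈⟨ +-cong (B-suc n h) (B-suc n (suc h)) ⟨
        w (suc n) h ∎
        where
        x₀ x₁ : Carrier
        x₀ = b[ h ] * w n h + pow R q h * u n h
        x₁ = b[ suc h ] * w n (suc h) + pow R q (suc h) * u n (suc h)
        down-at-0 : ∀ h → ŵ↓ n h 0 ≈ downB n h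
        down-at-0 zero = refl
        down-at-0 (suc h) = *-congˡ (ŵ-at-0 n h)

      v̂-at-0 : ∀ n h → v̂ n h 0 ≈ b[ h ] * w n h + pow R q h * u n h
      v̂-at-0 n h = trans
        (solve 5 (λ b p β w u → (b :* w :+ p :* ((con 0 :+ con 1 :* β) :* w)) :+ (p :* u) :* con 1
                   := (b :+ p :* β) :* w :+ p :* u)
          refl [ h ]q (pow R q h) β (ŵ n h 0) (u n h))
        (+-congʳ (*-congˡ (ŵ-at-0 n h)))

    historySum-suc : ∀ n → historySum R α β y q (suc n) ≈ y * v̂ n 0 0
    historySum-suc n = begin
      historySum R α β y q (suc n)                             ≈⟨ historySum-split (suc n) ⟩
      A (suc n) 0 + B (suc n) 0                                ≈⟨ +-cong (A-suc-zero n) (B-suc n 0) ⟩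
      0# + (y * (b[ 0 ] * w n 0 + pow R q 0 * u n 0) + 0#)     ≈⟨ trans (+-identityˡ _) (+-identityʳ _) ⟩
      y * (b[ 0 ] * w n 0 + pow R q 0 * u n 0)                 ≈⟨ *-congˡ (v̂-at-0 n 0) ⟨
      y * v̂ n 0 0 ∎

    -- Evaluation of normally ordered words.

    D^_one : ℕ → Row
    D^ zero one = one
    D^ suc j one = D (D^ j one)

    -- The vector one·(r E^i D^j): each E acts on `one` as the scalar `α`.
    evalTerm : Term R → Row
    evalTerm (r , i , j) m = (r * pow R α i) * (D^ j one) m

    eval : List (Term R) → Row
    eval ts m = sumOver (λ t → evalTerm t m) ts

    D-eval : ∀ ts m → D (eval ts) m ≈ sumOver (λ t → D (evalTerm t) m) ts
    D-eval [] m = D-0 m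
    D-eval (t ∷ ts) m = trans (D-+ (evalTerm t) (eval ts) m) (+-congˡ (D-eval ts m))

    E-eval : ∀ ts m → E (eval ts) m ≈ sumOver (λ t → E (evalTerm t) m) ts
    E-eval [] m = E-0 m
    E-eval (t ∷ ts) m = trans (E-+ (evalTerm t) (eval ts) m) (+-congˡ (E-eval ts m))

    pow-+ : ∀ x i j → pow R x (i +ℕ j) ≈ pow R x i * pow R x j
    pow-+ x zero j = sym (*-identityˡ _)
    pow-+ x (suc i) j = trans (*-congˡ (pow-+ x i j)) (sym (*-assoc _ _ _))

    -- The recursion of `DpowE` is `E-D` applied to the vector one·D^j, so normal ordering does not
    -- change the action.
    eval-DpowE : ∀ j m → eval (DpowE R q j) m ≈ E (D^ j one) m
    eval-DpowE zero m = trans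
      (solve 2 (λ α i → (con 1 :* (α :* con 1)) :* i :+ con 0 := α :* i) refl α (one m))
      (sym (E-one m))
    eval-DpowE (suc j) m = begin
      eval (DpowE R q (suc j)) m
        ≈⟨ sumOver-++ at (map _ (DpowE R q j)) _ ⟩
      sumOver at (map _ (DpowE R q j)) + (evalTerm (1# , 0 , suc j) m + eval (DpowE R q j) m)
        ≈⟨ +-cong
             (trans (reflexive (sumOver-map at _ (DpowE R q j))) (trans
               (sumOver-cong {g = λ t → q * D (evalTerm t) m}
                 (λ { (r , i , k) → trans
                   (solve 4 (λ q r a d → (q :* r :* a) :* d := q :* ((r :* a) :* d)) refl q r _ _)
                   (*-congˡ (sym (D-* _ _ m))) })
                 (DpowE R q j))
               (sumOver-* q (λ t → D (evalTerm t) m) (DpowE R q j))))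
             (+-congʳ (trans (*-congʳ (*-identityˡ _)) (*-identityˡ _))) ⟩
      q * sumOver (λ t → D (evalTerm t) m) (DpowE R q j) + (D (D^ j one) m + eval (DpowE R q j) m)
        ≈⟨ +-cong (*-congˡ (trans (sym (D-eval (DpowE R q j) m)) (D-cong (eval-DpowE j) m))) (+-congˡ (eval-DpowE j m)) ⟩
      q * D (E (D^ j one)) m + (D (D^ j one) m + E (D^ j one) m)
        ≈⟨ +-assoc _ _ _ ⟨
      q * D (E (D^ j one)) m + D (D^ j one) m + E (D^ j one) m
        ≈⟨ E-D (D^ j one) m ⟨
      E (D (D^ j one)) m ∎
      where
      at : Term R → Carrier
      at t = evalTerm t m

    -- Right multiplication of a word by yD + E: a new D joins D^j at once, a new E is carried
    -- through D^j by `DpowE`, and the E^i in front remains the scalar `pow R α i`.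
    eval-mulTerm : ∀ t m → eval (mulTerm R y q t) m ≈ y * D (evalTerm t) m + E (evalTerm t) m
    eval-mulTerm (r , i , j) m = +-cong
      (trans (solve 4 (λ y r a d → (y :* r :* a) :* d := y :* ((r :* a) :* d)) refl y r _ _)
             (*-congˡ (sym (D-* _ _ m))))
      (begin
        sumOver (λ t → evalTerm t m) (map _ (DpowE R q j))
          ≈⟨ trans (reflexive (sumOver-map (λ t → evalTerm t m) _ (DpowE R q j))) (sumOver-cong
               {g = λ t → (r * pow R α i) * evalTerm t m}
               (λ { (s , i' , j') → trans (*-congʳ (*-congˡ (pow-+ α i i')))
                 (solve 5 (λ r s a a' d → (r :* s :* (a :* a')) :* d := (r :* a) :* ((s :* a') :* d)) refl r s _ _ _) })
               (DpowE R q j)) ⟩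
        sumOver (λ t → (r * pow R α i) * evalTerm t m) (DpowE R q j)
          ≈⟨ sumOver-* _ (λ t → evalTerm t m) (DpowE R q j) ⟩
        (r * pow R α i) * eval (DpowE R q j) m
          ≈⟨ *-congˡ (eval-DpowE j m) ⟩
        (r * pow R α i) * E (D^ j one) m
          ≈⟨ E-* (r * pow R α i) (D^ j one) m ⟨
        E (evalTerm (r , i , j)) m ∎)

    eval-yDEpow-suc : ∀ n m → eval (yDEpow R y q (suc n)) m ≈ y * D (eval (yDEpow R y q n)) m + E (eval (yDEpow R y q n)) m
    eval-yDEpow-suc n m = begin
      eval (concatMap (mulTerm R y q) ts) m
        ≈⟨ sumOver-concatMap (λ t → evalTerm t m) (mulTerm R y q) ts ⟩
      sumOver (λ t → eval (mulTerm R y q t) m) ts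
        ≈⟨ sumOver-cong (λ t → eval-mulTerm t m) ts ⟩
      sumOver (λ t → y * D (evalTerm t) m + E (evalTerm t) m) ts
        ≈⟨ sumOver-+ _ _ ts ⟩
      sumOver (λ t → y * D (evalTerm t) m) ts + sumOver (λ t → E (evalTerm t) m) ts
        ≈⟨ +-cong (trans (sumOver-* y _ ts) (*-congˡ (sym (D-eval ts m)))) (sym (E-eval ts m)) ⟩
      y * D (eval ts) m + E (eval ts) m ∎
      where
      ts : List (Term R)
      ts = yDEpow R y q n

    eval-yDEpow : ∀ n m → eval (yDEpow R y q n) m ≈ v̂ n 0 m
    -- `v̂ 0 0` is `one`, since `u 0 0` counts only the empty history.
    eval-yDEpow zero m = sym (trans (+-congʳ (+-congˡ (*-congˡ (D-0 m))))
      (solve 1 (λ i → (con 0 :* con 0 :+ con 1 :* con 0) :+ (con 1 :* ((con 1 :* con 1 :+ con 0) :+ con 0)) :* i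
                  := (con 1 :* con 1) :* i :+ con 0) refl (one m)))
    eval-yDEpow (suc n) m = begin
      eval (yDEpow R y q (suc n)) m
        ≈⟨ eval-yDEpow-suc n m ⟩
      y * D (eval (yDEpow R y q n)) m + E (eval (yDEpow R y q n)) m
        ≈⟨ +-cong (*-congˡ (D-cong (eval-yDEpow n) m)) (E-cong (eval-yDEpow n) m) ⟩
      y * D (v̂ n 0) m + E (v̂ n 0) m
        ≈⟨ v̂-suc-0 n m ⟨
      v̂ (suc n) 0 m ∎

    D^one-at-0 : ∀ j → (D^ j one) 0 ≈ pow R β j
    D^one-at-0 zero = refl
    D^one-at-0 (suc j) = *-cong (trans (+-identityˡ _) (*-identityˡ β)) (D^one-at-0 j)

    -- The coordinate at 0 sends one·E^i D^j to α^i β^j.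
    Zbar≈eval : ∀ n → Zbar R α β y q n ≈ eval (yDEpow R y q n) 0
    Zbar≈eval n = go (λ { (r , i , j) acc → +-congʳ (*-congˡ (sym (D^one-at-0 j))) }) (yDEpow R y q n)
      where
      -- `Zbar` folds with an anonymous pattern-matching function, so `f` is kept arbitrary and
      -- compared with `evalTerm` pointwise.
      go : ∀ {f : Term R → Carrier → Carrier} → (∀ t acc → f t acc ≈ evalTerm t 0 + acc) →
        ∀ ts → foldr f 0# ts ≈ eval ts 0
      go f≈ [] = refl
      go f≈ (t ∷ ts) = trans (f≈ t _) (+-congˡ (go f≈ ts))

theorem3p8 : ∀ {c ℓ : Level} (R : CommutativeRing c ℓ) (α β y q : CommutativeRing.Carrier R) (N : ℕ) →
    CommutativeRing._≈_ R (CommutativeRing._*_ R y (Zbar R α β y q N)) (historySum R α β y q (suc N))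
theorem3p8 R α β y q N =
  trans (*-congˡ (trans (Zbar≈eval N) (eval-yDEpow N 0))) (sym (historySum-suc N))
  where
  open CommutativeRing R
  open Histories R α β y q
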